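{- Let $\lambda\in\mathbb{R}$, let $n$ be a positive integer and let $k$ be a positive integer. Then \[ S_{k,\lambda}(n)=\frac{(n)_{k+1,\lambda}}{k+1}+\frac{1}{k+1}\sum_{r=0}^{k-1}\binom{k+1}{r}(-1)^{k+1-r}\langle 1\rangle_{k+1-r,\lambda}\,S_{r,\lambda}(n). \]
   Context: For $\lambda\in\mathbb{R}$ the degenerate falling factorials are $(x)_{0,\lambda}=1$ and $(x)_{m,\lambda}=x(x-\lambda)\cdots(x-(m-1)\lambda)$ for $m\ge 1$, and the degenerate rising factorials are $\langle x\rangle_{0,\lambda}=1$ and $\langle x\rangle_{m,\lambda}=x(x+\lambda)(x+2\lambda)\cdots(x+(m-1)\lambda)$ for $m\ge1$. For a nonnegative integer $r$ and positive integer $n$, $S_{r,\lambda}(n)=\sum_{j=1}^{n}(j)_{r,\lambda}$ (so in particular $S_{0,\lambda}(n)=n$). -}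

module Defs where

open import Algebra.Bundles using (CommutativeRing)
open import Data.Fin.Base using (toℕ)
open import Data.Integer.Base using (+_; 1ℤ)
open import Data.Nat.Base as ℕ using (ℕ; zero; suc; NonZero)
import Data.Nat.Properties as ℕ
open import Data.Product.Base using (∃; _×_; _,_; proj₁; proj₂)
open import Data.Rational.Base as ℚ using (ℚ; 0ℚ; 1ℚ; ½; ∣_∣)
import Data.Rational.Properties as ℚ
open import Data.Rational.Solver using (module +-*-Solver)
open import Level using (0ℓ)
open import Relation.Binary.PropositionalEquality using (_≡_; refl; cong; subst)

------------------------------------------------------------------------
-- The real numbers as Cauchy sequences of rationals with pointwise
-- operations. Equality of reals is the setoid equality _≈_ (the
-- difference tends to 0), not _≡_.

IsCauchy : (ℕ → ℚ) → Set
IsCauchy s = ∀ ε → 0ℚ ℚ.< ε →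
  ∃ λ N → ∀ m n → N ℕ.≤ m → N ℕ.≤ n → ∣ s m ℚ.- s n ∣ ℚ.< ε

record ℝ : Set where
  constructor mkℝ
  field
    seq    : ℕ → ℚ
    cauchy : IsCauchy seq

open ℝ public

infix 4 _~_ _≈_

_~_ : (ℕ → ℚ) → (ℕ → ℚ) → Set
s ~ t = ∀ ε → 0ℚ ℚ.< ε →
  ∃ λ N → ∀ n → N ℕ.≤ n → ∣ s n ℚ.- t n ∣ ℚ.< ε

_≈_ : ℝ → ℝ → Set
x ≈ y = seq x ~ seq y

module _ where
  open +-*-Solver
  open ℚ.≤-Reasoning

  ∣p-p∣<ε : ∀ p {ε} → 0ℚ ℚ.< ε → ∣ p ℚ.- p ∣ ℚ.< ε
  ∣p-p∣<ε p 0<ε rewrite ℚ.+-inverseʳ p = 0<ε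

  ∣p-q∣≡∣q-p∣ : ∀ p q → ∣ p ℚ.- q ∣ ≡ ∣ q ℚ.- p ∣
  ∣p-q∣≡∣q-p∣ p q = begin-equality
    ∣ p ℚ.- q ∣        ≡⟨ cong ∣_∣ (solve 2 (λ p q → p :- q := :- (q :- p)) refl p q) ⟩
    ∣ ℚ.- (q ℚ.- p) ∣  ≡⟨ ℚ.∣-p∣≡∣p∣ (q ℚ.- p) ⟩
    ∣ q ℚ.- p ∣        ∎

  0<½* : ∀ {ε} → 0ℚ ℚ.< ε → 0ℚ ℚ.< ½ ℚ.* ε
  0<½* 0<ε = ℚ.*-monoʳ-<-pos ½ 0<ε

  ½+½ : ∀ ε → ½ ℚ.* ε ℚ.+ ½ ℚ.* ε ≡ ε
  ½+½ ε = begin-equality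
    ½ ℚ.* ε ℚ.+ ½ ℚ.* ε  ≡⟨ ℚ.*-distribʳ-+ ε ½ ½ ⟨
    1ℚ ℚ.* ε             ≡⟨ ℚ.*-identityˡ ε ⟩
    ε                    ∎

  -- If r splits as p + q with both parts below ε/2 then ∣ r ∣ < ε.
  split-< : ∀ {ε r} p q → r ≡ p ℚ.+ q →
            ∣ p ∣ ℚ.< ½ ℚ.* ε → ∣ q ∣ ℚ.< ½ ℚ.* ε → ∣ r ∣ ℚ.< ε
  split-< {ε} p q refl p< q< = begin-strict
    ∣ p ℚ.+ q ∣          ≤⟨ ℚ.∣p+q∣≤∣p∣+∣q∣ p q ⟩
    ∣ p ∣ ℚ.+ ∣ q ∣      <⟨ ℚ.+-mono-< p< q< ⟩
    ½ ℚ.* ε ℚ.+ ½ ℚ.* ε  ≡⟨ ½+½ ε ⟩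
    ε                    ∎

  +-close : ∀ {ε} a b c d → ∣ a ℚ.- c ∣ ℚ.< ½ ℚ.* ε → ∣ b ℚ.- d ∣ ℚ.< ½ ℚ.* ε →
            ∣ (a ℚ.+ b) ℚ.- (c ℚ.+ d) ∣ ℚ.< ε
  +-close a b c d = split-< (a ℚ.- c) (b ℚ.- d)
    (solve 4 (λ a b c d → (a :+ b) :- (c :+ d) := (a :- c) :+ (b :- d)) refl a b c d)

  neg-close : ∀ {ε} p q → ∣ p ℚ.- q ∣ ℚ.< ε → ∣ (ℚ.- p) ℚ.- (ℚ.- q) ∣ ℚ.< ε
  neg-close {ε} p q = subst (ℚ._< ε) (begin-equality
    ∣ p ℚ.- q ∣                ≡⟨ ℚ.∣-p∣≡∣p∣ (p ℚ.- q) ⟨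
    ∣ ℚ.- (p ℚ.- q) ∣          ≡⟨ cong ∣_∣ (solve 2 (λ p q → :- (p :- q) := (:- p) :- (:- q)) refl p q) ⟩
    ∣ (ℚ.- p) ℚ.- (ℚ.- q) ∣  ∎)

  module _ (B ε : ℚ) {{_ : ℚ.Positive B}} where
    private instance
      B≢0 : ℚ.NonZero B
      B≢0 = ℚ.pos⇒nonZero B

    scaled : ℚ
    scaled = ℚ.1/ B ℚ.* (½ ℚ.* ε)

    0<scaled : 0ℚ ℚ.< ε → 0ℚ ℚ.< scaled
    0<scaled 0<ε = subst (ℚ._< scaled) (ℚ.*-zeroʳ (ℚ.1/ B))
      (ℚ.*-monoʳ-<-pos (ℚ.1/ B) {{ℚ.1/pos⇒pos B}} (0<½* 0<ε))

    B*scaled : B ℚ.* scaled ≡ ½ ℚ.* ε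
    B*scaled = begin-equality
      B ℚ.* (ℚ.1/ B ℚ.* (½ ℚ.* ε))  ≡⟨ ℚ.*-assoc B (ℚ.1/ B) (½ ℚ.* ε) ⟨
      B ℚ.* ℚ.1/ B ℚ.* (½ ℚ.* ε)    ≡⟨ cong (ℚ._* (½ ℚ.* ε)) (ℚ.*-inverseʳ B) ⟩
      1ℚ ℚ.* (½ ℚ.* ε)              ≡⟨ ℚ.*-identityˡ (½ ℚ.* ε) ⟩
      ½ ℚ.* ε                       ∎

    bounded*small : ∀ p q → ∣ p ∣ ℚ.≤ B → ∣ q ∣ ℚ.< scaled → ∣ p ℚ.* q ∣ ℚ.< ½ ℚ.* ε
    bounded*small p q p≤ q< = begin-strict
      ∣ p ℚ.* q ∣      ≡⟨ ℚ.∣p*q∣≡∣p∣*∣q∣ p q ⟩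
      ∣ p ∣ ℚ.* ∣ q ∣  ≤⟨ ℚ.*-monoʳ-≤-nonNeg ∣ q ∣ {{ℚ.∣-∣-nonNeg q}} p≤ ⟩
      B ℚ.* ∣ q ∣      <⟨ ℚ.*-monoʳ-<-pos B q< ⟩
      B ℚ.* scaled     ≡⟨ B*scaled ⟩
      ½ ℚ.* ε          ∎

    *-close : ∀ a b c d → ∣ a ∣ ℚ.≤ B → ∣ d ∣ ℚ.≤ B →
              ∣ a ℚ.- c ∣ ℚ.< scaled → ∣ b ℚ.- d ∣ ℚ.< scaled →
              ∣ a ℚ.* b ℚ.- c ℚ.* d ∣ ℚ.< ε
    *-close a b c d a≤ d≤ a-c< b-d< = split-< (a ℚ.* (b ℚ.- d)) (d ℚ.* (a ℚ.- c))
      (solve 4 (λ a b c d → a :* b :- c :* d := a :* (b :- d) :+ d :* (a :- c)) refl a b c d)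
      (bounded*small a (b ℚ.- d) a≤ b-d<) (bounded*small d (a ℚ.- c) d≤ a-c<)

  0<1 : 0ℚ ℚ.< 1ℚ
  0<1 = ℚ.positive⁻¹ 1ℚ

  eventual-bound : ℝ → ℚ
  eventual-bound x = ∣ seq x (proj₁ (cauchy x 1ℚ 0<1)) ∣ ℚ.+ 1ℚ

  eventually-bounded : ∀ x → ∃ λ N → ∀ n → N ℕ.≤ n → ∣ seq x n ∣ ℚ.≤ eventual-bound x
  eventually-bounded x with cauchy x 1ℚ 0<1
  ... | N , close = N , λ n N≤n → begin
    ∣ seq x n ∣                            ≡⟨ cong ∣_∣ (solve 2 (λ p q → p := q :+ (p :- q)) refl (seq x n) (seq x N)) ⟩
    ∣ seq x N ℚ.+ (seq x n ℚ.- seq x N) ∣  ≤⟨ ℚ.∣p+q∣≤∣p∣+∣q∣ (seq x N) (seq x n ℚ.- seq x N) ⟩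
    ∣ seq x N ∣ ℚ.+ ∣ seq x n ℚ.- seq x N ∣ ≤⟨ ℚ.+-monoʳ-≤ ∣ seq x N ∣ (ℚ.<⇒≤ (close n N N≤n ℕ.≤-refl)) ⟩
    ∣ seq x N ∣ ℚ.+ 1ℚ                     ∎

  eventual-bound-pos : ∀ x → ℚ.Positive (eventual-bound x)
  eventual-bound-pos x = ℚ.nonNeg+pos⇒pos ∣ p ∣ {{ℚ.∣-∣-nonNeg p}} 1ℚ
    where p = seq x (proj₁ (cauchy x 1ℚ 0<1))

  p≤p+q : ∀ p q → ℚ.Positive q → p ℚ.≤ p ℚ.+ q
  p≤p+q p q q-pos = begin
    p         ≡⟨ ℚ.+-identityʳ p ⟨
    p ℚ.+ 0ℚ  ≤⟨ ℚ.+-monoʳ-≤ p (ℚ.<⇒≤ (ℚ.positive⁻¹ q {{q-pos}})) ⟩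
    p ℚ.+ q   ∎

  q≤p+q : ∀ p q → ℚ.Positive p → q ℚ.≤ p ℚ.+ q
  q≤p+q p q p-pos = subst (q ℚ.≤_) (ℚ.+-comm q p) (p≤p+q q p p-pos)

  join-bounds : ∀ (s t : ℕ → ℚ) A B M N → ℚ.Positive A → ℚ.Positive B →
    (∀ n → M ℕ.≤ n → ∣ s n ∣ ℚ.≤ A) → (∀ n → N ℕ.≤ n → ∣ t n ∣ ℚ.≤ B) →
    ∃ λ C → ∃ λ K → ℚ.Positive C × (∀ n → K ℕ.≤ n → ∣ s n ∣ ℚ.≤ C × ∣ t n ∣ ℚ.≤ C)
  join-bounds s t A B M N A-pos B-pos s≤ t≤ =
    A ℚ.+ B , M ℕ.⊔ N , ℚ.pos+pos⇒pos A {{A-pos}} B {{B-pos}} , λ n ≤n →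
      ℚ.≤-trans (s≤ n (ℕ.m⊔n≤o⇒m≤o M N ≤n)) (p≤p+q A B B-pos) ,
      ℚ.≤-trans (t≤ n (ℕ.m⊔n≤o⇒n≤o M N ≤n)) (q≤p+q A B A-pos)

  jointly-bounded : ∀ x y → ∃ λ B → ∃ λ N → ℚ.Positive B ×
    (∀ n → N ℕ.≤ n → ∣ seq x n ∣ ℚ.≤ B × ∣ seq y n ∣ ℚ.≤ B)
  jointly-bounded x y = join-bounds (seq x) (seq y) (eventual-bound x) (eventual-bound y)
    (proj₁ (eventually-bounded x)) (proj₁ (eventually-bounded y))
    (eventual-bound-pos x) (eventual-bound-pos y)
    (proj₂ (eventually-bounded x)) (proj₂ (eventually-bounded y))

  *-cauchy : ∀ {s t B K} → ℚ.Positive B →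
    (∀ n → K ℕ.≤ n → ∣ s n ∣ ℚ.≤ B × ∣ t n ∣ ℚ.≤ B) →
    IsCauchy s → IsCauchy t → IsCauchy (λ n → s n ℚ.* t n)
  *-cauchy {s} {t} {B} {K} B-pos ≤B s-cauchy t-cauchy ε 0<ε =
    combine (s-cauchy δ 0<δ) (t-cauchy δ 0<δ)
    where
    δ = scaled B ε {{B-pos}}
    0<δ = 0<scaled B ε {{B-pos}} 0<ε
    combine : (∃ λ N → ∀ m n → N ℕ.≤ m → N ℕ.≤ n → ∣ s m ℚ.- s n ∣ ℚ.< δ) →
              (∃ λ N → ∀ m n → N ℕ.≤ m → N ℕ.≤ n → ∣ t m ℚ.- t n ∣ ℚ.< δ) →
              ∃ λ N → ∀ m n → N ℕ.≤ m → N ℕ.≤ n → ∣ s m ℚ.* t m ℚ.- s n ℚ.* t n ∣ ℚ.< ε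
    combine (M , s<) (N , t<) = K ℕ.⊔ (M ℕ.⊔ N) , λ m n ≤m ≤n →
      let M⊔N≤m = ℕ.m⊔n≤o⇒n≤o K (M ℕ.⊔ N) ≤m
          M⊔N≤n = ℕ.m⊔n≤o⇒n≤o K (M ℕ.⊔ N) ≤n
      in *-close B ε {{B-pos}} (s m) (t m) (s n) (t n)
        (proj₁ (≤B m (ℕ.m⊔n≤o⇒m≤o K (M ℕ.⊔ N) ≤m)))
        (proj₂ (≤B n (ℕ.m⊔n≤o⇒m≤o K (M ℕ.⊔ N) ≤n)))
        (s< m n (ℕ.m⊔n≤o⇒m≤o M N M⊔N≤m) (ℕ.m⊔n≤o⇒m≤o M N M⊔N≤n))
        (t< m n (ℕ.m⊔n≤o⇒n≤o M N M⊔N≤m) (ℕ.m⊔n≤o⇒n≤o M N M⊔N≤n))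

  *-~ : ∀ {s s′ t t′ B K} → ℚ.Positive B →
    (∀ n → K ℕ.≤ n → ∣ s n ∣ ℚ.≤ B × ∣ t′ n ∣ ℚ.≤ B) →
    s ~ s′ → t ~ t′ →
    (λ n → s n ℚ.* t n) ~ (λ n → s′ n ℚ.* t′ n)
  *-~ {s} {s′} {t} {t′} {B} {K} B-pos ≤B s∼ t∼ ε 0<ε = combine (s∼ δ 0<δ) (t∼ δ 0<δ)
    where
    δ = scaled B ε {{B-pos}}
    0<δ = 0<scaled B ε {{B-pos}} 0<ε
    combine : (∃ λ N → ∀ n → N ℕ.≤ n → ∣ s n ℚ.- s′ n ∣ ℚ.< δ) →
              (∃ λ N → ∀ n → N ℕ.≤ n → ∣ t n ℚ.- t′ n ∣ ℚ.< δ) →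
              ∃ λ N → ∀ n → N ℕ.≤ n → ∣ s n ℚ.* t n ℚ.- s′ n ℚ.* t′ n ∣ ℚ.< ε
    combine (M , s<) (N , t<) = K ℕ.⊔ (M ℕ.⊔ N) , λ n ≤n →
      let K≤n   = ℕ.m⊔n≤o⇒m≤o K (M ℕ.⊔ N) ≤n
          M⊔N≤n = ℕ.m⊔n≤o⇒n≤o K (M ℕ.⊔ N) ≤n
      in *-close B ε {{B-pos}} (s n) (t n) (s′ n) (t′ n)
        (proj₁ (≤B n K≤n)) (proj₂ (≤B n K≤n))
        (s< n (ℕ.m⊔n≤o⇒m≤o M N M⊔N≤n)) (t< n (ℕ.m⊔n≤o⇒n≤o M N M⊔N≤n))

fromℚ : ℚ → ℝ
fromℚ p = mkℝ (λ _ → p) λ ε 0<ε → 0 , λ _ _ _ _ → ∣p-p∣<ε p 0<ε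

fromℕ : ℕ → ℝ
fromℕ n = fromℚ (+ n ℚ./ 1)

infix  8 -_
infixl 7 _*_ _÷_
infixl 6 _+_ _-_

_+_ : ℝ → ℝ → ℝ
x + y = mkℝ (λ n → seq x n ℚ.+ seq y n) +-cauchy
  where
  +-cauchy : IsCauchy (λ n → seq x n ℚ.+ seq y n)
  +-cauchy ε 0<ε with cauchy x (½ ℚ.* ε) (0<½* 0<ε) | cauchy y (½ ℚ.* ε) (0<½* 0<ε)
  ... | M , x< | N , y< = M ℕ.⊔ N , λ m n ≤m ≤n →
    +-close (seq x m) (seq y m) (seq x n) (seq y n)
      (x< m n (ℕ.m⊔n≤o⇒m≤o M N ≤m) (ℕ.m⊔n≤o⇒m≤o M N ≤n))
      (y< m n (ℕ.m⊔n≤o⇒n≤o M N ≤m) (ℕ.m⊔n≤o⇒n≤o M N ≤n))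

-_ : ℝ → ℝ
- x = mkℝ (λ n → ℚ.- seq x n) neg-cauchy
  where
  neg-cauchy : IsCauchy (λ n → ℚ.- seq x n)
  neg-cauchy ε 0<ε with cauchy x ε 0<ε
  ... | N , x< = N , λ m n ≤m ≤n → neg-close (seq x m) (seq x n) (x< m n ≤m ≤n)

_-_ : ℝ → ℝ → ℝ
x - y = x + (- y)

_*_ : ℝ → ℝ → ℝ
x * y = mkℝ (λ n → seq x n ℚ.* seq y n)
  (let _ , _ , B-pos , ≤B = jointly-bounded x y in *-cauchy B-pos ≤B (cauchy x) (cauchy y))

0ℝ 1ℝ : ℝ
0ℝ = fromℚ 0ℚ
1ℝ = fromℚ 1ℚ

_÷_ : ℝ → (n : ℕ) → .{{NonZero n}} → ℝ
x ÷ n = x * fromℚ (1ℤ ℚ./ n)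

pointwise : ∀ {x y} → (∀ n → seq x n ≡ seq y n) → x ≈ y
pointwise {x} {y} x≗y ε 0<ε = 0 , λ n _ →
  subst (λ q → ∣ seq x n ℚ.- q ∣ ℚ.< ε) (x≗y n) (∣p-p∣<ε (seq x n) 0<ε)

≈-refl : ∀ {x} → x ≈ x
≈-refl {x} = pointwise {x} {x} λ _ → refl

≈-sym : ∀ {x y} → x ≈ y → y ≈ x
≈-sym {x} {y} x≈y ε 0<ε with x≈y ε 0<ε
... | N , close = N , λ n N≤n →
  subst (ℚ._< ε) (∣p-q∣≡∣q-p∣ (seq x n) (seq y n)) (close n N≤n)

≈-trans : ∀ {x y z} → x ≈ y → y ≈ z → x ≈ z
≈-trans {x} {y} {z} x≈y y≈z ε 0<ε with x≈y (½ ℚ.* ε) (0<½* 0<ε) | y≈z (½ ℚ.* ε) (0<½* 0<ε)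
... | M , x-y< | N , y-z< = M ℕ.⊔ N , λ n ≤n →
  split-< (seq x n ℚ.- seq y n) (seq y n ℚ.- seq z n)
    (solve 3 (λ p q r → p :- r := (p :- q) :+ (q :- r)) refl (seq x n) (seq y n) (seq z n))
    (x-y< n (ℕ.m⊔n≤o⇒m≤o M N ≤n)) (y-z< n (ℕ.m⊔n≤o⇒n≤o M N ≤n))
  where open +-*-Solver

+-cong : ∀ {x x′ y y′} → x ≈ x′ → y ≈ y′ → x + y ≈ x′ + y′
+-cong {x} {x′} {y} {y′} x≈ y≈ ε 0<ε with x≈ (½ ℚ.* ε) (0<½* 0<ε) | y≈ (½ ℚ.* ε) (0<½* 0<ε)
... | M , x< | N , y< = M ℕ.⊔ N , λ n ≤n →
  +-close (seq x n) (seq y n) (seq x′ n) (seq y′ n)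
    (x< n (ℕ.m⊔n≤o⇒m≤o M N ≤n)) (y< n (ℕ.m⊔n≤o⇒n≤o M N ≤n))

-‿cong : ∀ {x x′} → x ≈ x′ → - x ≈ - x′
-‿cong {x} {x′} x≈ ε 0<ε with x≈ ε 0<ε
... | N , x< = N , λ n ≤n → neg-close (seq x n) (seq x′ n) (x< n ≤n)

*-cong : ∀ {x x′ y y′} → x ≈ x′ → y ≈ y′ → x * y ≈ x′ * y′
*-cong {x} {x′} {y} {y′} x≈ y≈ =
  let _ , _ , B-pos , ≤B = jointly-bounded x y′
  in *-~ {seq x} {seq x′} {seq y} {seq y′} B-pos ≤B x≈ y≈

ℝ-commutativeRing : CommutativeRing 0ℓ 0ℓ
ℝ-commutativeRing = record
  { Carrier = ℝ
  ; _≈_ = _≈_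
  ; _+_ = _+_
  ; _*_ = _*_
  ; -_  = -_
  ; 0#  = 0ℝ
  ; 1#  = 1ℝ
  ; isCommutativeRing = record
    { isRing = record
      { +-isAbelianGroup = record
        { isGroup = record
          { isMonoid = record
            { isSemigroup = record
              { isMagma = record
                { isEquivalence = record
                  { refl  = λ {x} → ≈-refl {x}
                  ; sym   = λ {x y} → ≈-sym {x} {y}
                  ; trans = λ {x y z} → ≈-trans {x} {y} {z}
                  }
                ; ∙-cong = λ {x x′ y y′} → +-cong {x} {x′} {y} {y′}
                }
              ; assoc = λ x y z → pointwise {(x + y) + z} {x + (y + z)} λ n →
                  ℚ.+-assoc (seq x n) (seq y n) (seq z n)
              }
            ; identity =
                (λ x → pointwise {0ℝ + x} {x} λ n → ℚ.+-identityˡ (seq x n)) ,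
                (λ x → pointwise {x + 0ℝ} {x} λ n → ℚ.+-identityʳ (seq x n))
            }
          ; inverse =
              (λ x → pointwise {(- x) + x} {0ℝ} λ n → ℚ.+-inverseˡ (seq x n)) ,
              (λ x → pointwise {x + (- x)} {0ℝ} λ n → ℚ.+-inverseʳ (seq x n))
          ; ⁻¹-cong = λ {x x′} → -‿cong {x} {x′}
          }
        ; comm = λ x y → pointwise {x + y} {y + x} λ n → ℚ.+-comm (seq x n) (seq y n)
        }
      ; *-cong = λ {x x′ y y′} → *-cong {x} {x′} {y} {y′}
      ; *-assoc = λ x y z → pointwise {(x * y) * z} {x * (y * z)} λ n →
          ℚ.*-assoc (seq x n) (seq y n) (seq z n)
      ; *-identity =
          (λ x → pointwise {1ℝ * x} {x} λ n → ℚ.*-identityˡ (seq x n)) ,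
          (λ x → pointwise {x * 1ℝ} {x} λ n → ℚ.*-identityʳ (seq x n))
      ; distrib =
          (λ x y z → pointwise {x * (y + z)} {x * y + x * z} λ n →
            ℚ.*-distribˡ-+ (seq x n) (seq y n) (seq z n)) ,
          (λ x y z → pointwise {(y + z) * x} {y * x + z * x} λ n →
            ℚ.*-distribʳ-+ (seq x n) (seq y n) (seq z n))
      }
    ; *-comm = λ x y → pointwise {x * y} {y * x} λ n → ℚ.*-comm (seq x n) (seq y n)
    }
  }

open import Algebra.Properties.Semiring.Exp
  (CommutativeRing.semiring ℝ-commutativeRing) public
  using (_^_)
open import Algebra.Properties.CommutativeMonoid.Sum
  (CommutativeRing.+-commutativeMonoid ℝ-commutativeRing) public
  using (sum; sum-syntax)

------------------------------------------------------------------------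
-- Degenerate factorials and power sums, with parameter l (the usual λ)

-- (x)_{m,l} = x (x - l) ⋯ (x - (m-1) l)
falling : ℝ → ℝ → ℕ → ℝ
falling l x zero    = 1ℝ
falling l x (suc m) = falling l x m * (x - fromℕ m * l)

-- ⟨x⟩_{m,l} = x (x + l) ⋯ (x + (m-1) l)
rising : ℝ → ℝ → ℕ → ℝ
rising l x zero    = 1ℝ
rising l x (suc m) = rising l x m * (x + fromℕ m * l)

-- S_{r,l}(n) = ∑_{j=1}^{n} (j)_{r,l}; the index i below is j - 1.
S : ℝ → ℕ → ℕ → ℝ
S l r n = ∑[ i < n ] falling l (fromℕ (suc (toℕ i))) r

{-# OPTIONS --safe #-}

-- Since ⟨1⟩_{m,λ} = (-1)^m (-1)_{m,λ}, the binomial (Vandermonde) theorem for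
-- degenerate falling factorials expands (j - 1)_{k+1,λ} in the (j)_{r,λ} with
-- coefficients C(k+1, r) (-1)^{k+1-r} ⟨1⟩_{k+1-r,λ}. Its top two terms are
-- (j)_{k+1,λ} and -(k+1) (j)_{k,λ}; summing over j = 1, …, n, the terms
-- (j)_{k+1,λ} - (j - 1)_{k+1,λ} telescope to (n)_{k+1,λ} and the rest is the
-- claim.
module Submission where

open import Algebra.Bundles using (CommutativeRing)
open import Data.Fin.Base using (Fin; toℕ; inject₁)
import Data.Fin.Base as Fin using (fromℕ)
open import Data.Fin.Properties using (toℕ-inject₁; toℕ-fromℕ; toℕ<n)
open import Data.Integer.Base as ℤ using (+_; 1ℤ)
import Data.Integer.Properties as ℤ
open import Data.Nat.Base as ℕ using (ℕ; zero; suc; _∸_; _≤_; z≤n; NonZero)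
open import Data.Nat.Combinatorics using (_C_; nCn≡1; nC1≡n; nCk≡nC[n∸k]; nCk+nC[k+1]≡[n+1]C[k+1]; k>n⇒nCk≡0)
import Data.Nat.Properties as ℕ
open import Data.Rational.Base as ℚ using (1ℚ; fromℚᵘ)
import Data.Rational.Properties as ℚ
open import Data.Rational.Unnormalised.Base as ℚᵘ using (mkℚᵘ; *≡*)
import Data.Rational.Unnormalised.Properties as ℚᵘ
open import Function.Base using (_∘_)
open import Relation.Binary.PropositionalEquality as ≡ using (_≡_; cong; cong₂)

-- These laws force `ι n` to be the n-fold sum of `1#`. Keeping `ι` arbitrary lets `fromℕ`, which
-- goes through the rationals, be used as it is.
record IsNaturalEmbedding {c ℓ} (R : CommutativeRing c ℓ)
                          (ι : ℕ → CommutativeRing.Carrier R) : Set ℓ where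
  open CommutativeRing R using (_≈_; _+_; 0#; 1#)
  field
    ι-0 : ι 0 ≈ 0#
    ι-1 : ι 1 ≈ 1#
    ι-+ : ∀ m n → ι (m ℕ.+ n) ≈ ι m + ι n

-- The argument is carried out in an abstract ring because there, unlike in ℝ,
-- the sides of an equation can be inferred from its type.
module DegenerateFactorials {c ℓ} (R : CommutativeRing c ℓ)
  {ι : ℕ → CommutativeRing.Carrier R} (ι-embedding : IsNaturalEmbedding R ι)
  (l : CommutativeRing.Carrier R)
  where

  -- Degenerate factorials in a commutative ring.

  open CommutativeRing R hiding (zero)
  open IsNaturalEmbedding ι-embedding
  open import Algebra.Properties.Ring ring using (-1*x≈-x; -0#≈0#; +-cancelʳ)
  open import Algebra.Properties.AbelianGroup +-abelianGroup using (⁻¹-∙-comm)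
  open import Algebra.Properties.Semiring.Exp semiring using (_^_)
  open import Algebra.Properties.Semiring.Sum semiring
  open import Relation.Binary.Reasoning.Setoid setoid
  open import Algebra.Solver.Ring.NaturalCoefficients.Default commutativeSemiring
    using (solve; _:=_; _:+_; _:*_; con)

  -- A characterisation by the recurrence up to `≈` instead of a definition, so that it also covers
  -- the signed rising factorials, which satisfy the recurrence only up to `≈`.
  record IsFalling (x : Carrier) (a : ℕ → Carrier) : Set ℓ where
    field
      base : a 0 ≈ 1#
      step : ∀ m → a (suc m) ≈ a m * (x - ι m * l)

  record IsRising (x : Carrier) (a : ℕ → Carrier) : Set ℓ where
    field
      base : a 0 ≈ 1#
      step : ∀ m → a (suc m) ≈ a m * (x + ι m * l)

  open IsFalling
  open IsRising

  ∑-snoc : ∀ (f : ℕ → Carrier) n →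
           ∑[ i < suc n ] f (toℕ i) ≈ ∑[ i < n ] f (toℕ i) + f n
  ∑-snoc f n = begin
    ∑[ i < suc n ] f (toℕ i)
      ≈⟨ sum-init-last {n} (f ∘ toℕ) ⟩
    ∑[ i < n ] f (toℕ (inject₁ i)) + f (toℕ (Fin.fromℕ n))
      ≡⟨ cong₂ _+_ (sum-cong-≗ {n} λ i → cong f (toℕ-inject₁ i)) (cong f (toℕ-fromℕ n)) ⟩
    ∑[ i < n ] f (toℕ i) + f n ∎

  ∑-snoc₂ : ∀ (f : ℕ → Carrier) n →
            ∑[ i < suc (suc n) ] f (toℕ i) ≈ ∑[ i < n ] f (toℕ i) + (f n + f (suc n))
  ∑-snoc₂ f n = begin
    ∑[ i < suc (suc n) ] f (toℕ i)              ≈⟨ ∑-snoc f (suc n) ⟩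
    ∑[ i < suc n ] f (toℕ i) + f (suc n)        ≈⟨ +-congʳ (∑-snoc f n) ⟩
    ∑[ i < n ] f (toℕ i) + f n + f (suc n)      ≈⟨ +-assoc _ _ _ ⟩
    ∑[ i < n ] f (toℕ i) + (f n + f (suc n))    ∎

  -- Each new factor -1 of the power, distributed over the new factor 1 + mλ, gives -1 - mλ.
  IsRising⇒IsFalling-1 : ∀ {h} → IsRising 1# h → IsFalling (- 1#) (λ m → (- 1#) ^ m * h m)
  IsRising⇒IsFalling-1 {h} h-rising .base = trans (*-identityˡ (h 0)) (h-rising .base)
  IsRising⇒IsFalling-1 {h} h-rising .step m = begin
    (- 1# * p) * h (suc m)
      ≈⟨ *-congˡ (h-rising .step m) ⟩
    (- 1# * p) * (h m * (1# + q))
      ≈⟨ solve 4 (λ e p a q → (e :* p) :* (a :* (con 1 :+ q)) := p :* a :* (e :+ e :* q))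
           refl (- 1#) p (h m) q ⟩
    p * h m * (- 1# + - 1# * q)
      ≈⟨ *-congˡ (+-congˡ (-1*x≈-x q)) ⟩
    p * h m * (- 1# - q) ∎
    where
    p = (- 1#) ^ m
    q = ι m * l

  -- The binomial theorem for degenerate falling factorials.

  convolution-term : (a b : ℕ → Carrier) → ℕ → ℕ → Carrier
  convolution-term a b m r = ι (m C r) * (a r * b (m ∸ r))

  convolution : (a b : ℕ → Carrier) → ℕ → Carrier
  convolution a b m = ∑[ r < suc m ] convolution-term a b m (toℕ r)

  nC0≡1 : ∀ n → n C 0 ≡ 1
  nC0≡1 n = ≡.trans (nCk≡nC[n∸k] {0} {n} z≤n) (nCn≡1 n)

  module _ {x y} {a b : ℕ → Carrier} (a-falling : IsFalling x a) (b-falling : IsFalling y b) where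

    private
      -- Split x + y - mλ as (x - rλ) + (y - (m - r)λ): the first part raises the index of `a`, the
      -- second that of `b`.
      term-* : ∀ m r → r ≤ m →
        convolution-term a b m r * (x + y - ι m * l) ≈
        ι (m C r) * (a (suc r) * b (m ∸ r)) + ι (m C r) * (a r * b (suc m ∸ r))
      term-* m r r≤m = begin
        ι (m C r) * (a r * b (m ∸ r)) * (x + y - ι m * l)
          ≈⟨ *-congˡ (+-congˡ -ιm*l) ⟩
        ι (m C r) * (a r * b (m ∸ r)) * (x + y + (- (ι r * l) - ι (m ∸ r) * l))
          ≈⟨ solve 7 (λ p a b x y r s → p :* (a :* b) :* (x :+ y :+ (r :+ s)) :=
                                        p :* (a :* (x :+ r) :* b) :+ p :* (a :* (b :* (y :+ s))))
               refl (ι (m C r)) (a r) (b (m ∸ r)) x y (- (ι r * l)) (- (ι (m ∸ r) * l)) ⟩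
        ι (m C r) * (a r * (x - ι r * l) * b (m ∸ r)) +
        ι (m C r) * (a r * (b (m ∸ r) * (y - ι (m ∸ r) * l)))
          ≈⟨ +-cong (*-congˡ (*-congʳ (a-falling .step r))) (*-congˡ (*-congˡ (b-falling .step (m ∸ r)))) ⟨
        ι (m C r) * (a (suc r) * b (m ∸ r)) + ι (m C r) * (a r * b (suc (m ∸ r)))
          ≡⟨ cong (λ i → ι (m C r) * (a (suc r) * b (m ∸ r)) + ι (m C r) * (a r * b i)) (ℕ.+-∸-assoc 1 r≤m) ⟨
        ι (m C r) * (a (suc r) * b (m ∸ r)) + ι (m C r) * (a r * b (suc m ∸ r)) ∎
        where
        -ιm*l : - (ι m * l) ≈ - (ι r * l) - ι (m ∸ r) * l
        -ιm*l = begin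
          - (ι m * l)                     ≡⟨ cong (λ i → - (ι i * l)) (ℕ.m+[n∸m]≡n r≤m) ⟨
          - (ι (r ℕ.+ (m ∸ r)) * l)       ≈⟨ -‿cong (trans (*-congʳ (ι-+ r (m ∸ r))) (distribʳ l _ _)) ⟩
          - (ι r * l + ι (m ∸ r) * l)     ≈⟨ ⁻¹-∙-comm (ι r * l) (ι (m ∸ r) * l) ⟨
          - (ι r * l) - ι (m ∸ r) * l     ∎

    -- Pascal's rule splits the left side into the two sums `A` and `B`, which `term-*` recombines
    -- into the right side.
    convolution-suc : ∀ m → convolution a b (suc m) ≈ convolution a b m * (x + y - ι m * l)
    convolution-suc m = begin
      v (suc m) 0 + ∑[ r < suc m ] (ι (suc m C suc (toℕ r)) * t (toℕ r))
        ≈⟨ +-cong (*-congʳ (reflexive (cong ι (≡.trans (nC0≡1 (suc m)) (≡.sym (nC0≡1 m))))))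
                  (sum-cong-≋ {suc m} (pascal ∘ toℕ)) ⟩
      v m 0 + ∑[ r < suc m ] (ι (m C toℕ r) * t (toℕ r) + v m (suc (toℕ r)))
        ≈⟨ +-congˡ (∑-distrib-+ {suc m} (λ r → ι (m C toℕ r) * t (toℕ r)) (v m ∘ suc ∘ toℕ)) ⟩
      v m 0 + (A + ∑[ r < suc m ] v m (suc (toℕ r)))
        -- `v m 0` is the missing head of the shifted sum. The sum then runs one index beyond `B`,
        -- where the binomial coefficient is 0.
        ≈⟨ solve 3 (λ p q r → p :+ (q :+ r) := q :+ (p :+ r)) refl (v m 0) A _ ⟩
      A + ∑[ r < suc (suc m) ] v m (toℕ r)
        ≈⟨ +-congˡ (∑-snoc (v m) (suc m)) ⟩
      A + (B + v m (suc m))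
        ≈⟨ +-congˡ (trans (+-congˡ v-last) (+-identityʳ B)) ⟩
      A + B
        ≈⟨ ∑-distrib-+ {suc m} (λ r → ι (m C toℕ r) * t (toℕ r)) (v m ∘ toℕ) ⟨
      ∑[ r < suc m ] (ι (m C toℕ r) * t (toℕ r) + v m (toℕ r))
        ≈⟨ sum-cong-≋ {suc m} (λ r → term-* m (toℕ r) (ℕ.s≤s⁻¹ (toℕ<n r))) ⟨
      ∑[ r < suc m ] (convolution-term a b m (toℕ r) * (x + y - ι m * l))
        ≈⟨ *-distribʳ-sum (x + y - ι m * l) (convolution-term a b m ∘ toℕ {suc m}) ⟨
      convolution a b m * (x + y - ι m * l) ∎
      where
      t : ℕ → Carrier
      t r = a (suc r) * b (m ∸ r)
      -- Only the binomial coefficient depends on `n`; the factorials stay those of degree `suc m`,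
      -- so that `v m` and `v (suc m)` can be compared.
      v : ℕ → ℕ → Carrier
      v n r = ι (n C r) * (a r * b (suc m ∸ r))
      A = ∑[ r < suc m ] (ι (m C toℕ r) * t (toℕ r))
      B = ∑[ r < suc m ] v m (toℕ r)
      pascal : ∀ r → ι (suc m C suc r) * t r ≈ ι (m C r) * t r + v m (suc r)
      pascal r = begin
        ι (suc m C suc r) * t r            ≡⟨ cong (λ i → ι i * t r) (nCk+nC[k+1]≡[n+1]C[k+1] m r) ⟨
        ι (m C r ℕ.+ m C suc r) * t r      ≈⟨ *-congʳ (ι-+ (m C r) (m C suc r)) ⟩
        (ι (m C r) + ι (m C suc r)) * t r  ≈⟨ distribʳ (t r) _ _ ⟩
        ι (m C r) * t r + v m (suc r)      ∎
      v-last : v m (suc m) ≈ 0#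
      v-last = trans (*-congʳ (trans (reflexive (cong ι (k>n⇒nCk≡0 (ℕ.n<1+n m)))) ι-0)) (zeroˡ _)

    -- By induction, as both sides acquire the same factor. The decomposition of `z` is a hypothesis
    -- because it is applied to `ι j`, which equals `ι (suc j) + - 1#` only up to `≈`.
    vandermonde : ∀ {z d} → z ≈ x + y → IsFalling z d → ∀ m → d m ≈ convolution a b m
    vandermonde {z} {d} z≈ d-falling zero = begin
      d 0
        ≈⟨ d-falling .base ⟩
      1#
        ≈⟨ trans (+-identityʳ _) (trans (*-identityˡ _) (*-identityˡ 1#)) ⟨
      1# * (1# * 1#) + 0#
        ≈⟨ +-congʳ (*-cong (trans (reflexive (cong ι (nC0≡1 0))) ι-1)
                           (*-cong (a-falling .base) (b-falling .base))) ⟨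
      ι (0 C 0) * (a 0 * b 0) + 0# ∎
    vandermonde {z} {d} z≈ d-falling (suc m) = begin
      d (suc m)                                  ≈⟨ d-falling .step m ⟩
      d m * (z - ι m * l)                        ≈⟨ *-cong (vandermonde z≈ d-falling m) (+-congʳ z≈) ⟩
      convolution a b m * (x + y - ι m * l)      ≈⟨ convolution-suc m ⟨
      convolution a b (suc m)                    ∎

  -- Recurrence and closed formula for the power sums.

  x-ι0*y≈x : ∀ x y → x - ι 0 * y ≈ x
  x-ι0*y≈x x y = begin
    x - ι 0 * y    ≈⟨ +-congˡ (-‿cong (trans (*-congʳ ι-0) (zeroˡ y))) ⟩
    x - 0#         ≈⟨ +-congˡ -0#≈0# ⟩
    x + 0#         ≈⟨ +-identityʳ x ⟩
    x              ∎

  -- The very first factor is 0 - 0λ.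
  falling-0 : ∀ {a} → IsFalling (ι 0) a → ∀ m → a (suc m) ≈ 0#
  falling-0 {a} a-falling zero = begin
    a 1                       ≈⟨ a-falling .step 0 ⟩
    a 0 * (ι 0 - ι 0 * l)     ≈⟨ *-congˡ (trans (x-ι0*y≈x (ι 0) l) ι-0) ⟩
    a 0 * 0#                  ≈⟨ zeroʳ (a 0) ⟩
    0#                        ∎
  falling-0 a-falling (suc m) =
    trans (a-falling .step (suc m)) (trans (*-congʳ (falling-0 a-falling m)) (zeroˡ _))

  module _ {f : ℕ → ℕ → Carrier} {h : ℕ → Carrier}
    (f-falling : ∀ j → IsFalling (ι j) (f j)) (h-rising : IsRising 1# h) where

    private
      g : ℕ → Carrier
      g m = (- 1#) ^ m * h m

      g-falling : IsFalling (- 1#) g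
      g-falling = IsRising⇒IsFalling-1 h-rising

      pred-shift : ∀ j → ι j ≈ ι (suc j) + - 1#
      pred-shift j = begin
        ι j
          ≈⟨ +-identityˡ (ι j) ⟨
        0# + ι j
          ≈⟨ +-congʳ (-‿inverseʳ 1#) ⟨
        (1# + - 1#) + ι j
          ≈⟨ solve 3 (λ p q r → p :+ q :+ r := p :+ r :+ q) refl 1# (- 1#) (ι j) ⟩
        (1# + ι j) + - 1#
          ≈⟨ +-congʳ (+-congʳ ι-1) ⟨
        (ι 1 + ι j) + - 1#
          ≈⟨ +-congʳ (ι-+ 1 j) ⟨
        ι (suc j) + - 1# ∎

      g-1 : g 1 ≈ - 1#
      g-1 = begin
        g 1                           ≈⟨ g-falling .step 0 ⟩
        g 0 * (- 1# - ι 0 * l)        ≈⟨ *-cong (g-falling .base) (x-ι0*y≈x (- 1#) l) ⟩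
        1# * - 1#                     ≈⟨ *-identityˡ (- 1#) ⟩
        - 1#                          ∎

      [1+n]Cn≡1+n : ∀ n → suc n C n ≡ suc n
      [1+n]Cn≡1+n n = ≡.trans (nCk≡nC[n∸k] (ℕ.n≤1+n n))
        (≡.trans (cong (suc n C_) (ℕ.m+n∸n≡m 1 n)) (nC1≡n (suc n)))

    power-sum : ℕ → ℕ → Carrier
    power-sum r n = ∑[ i < n ] f (suc (toℕ i)) r

    summand : ℕ → ℕ → ℕ → Carrier
    summand n k r = ι (suc k C r) * (- 1#) ^ (suc k ∸ r) * h (suc k ∸ r) * power-sum r n

    -- The binomial theorem for j = (j + 1) + (-1). The top two terms are set apart: on summation,
    -- degree `k` yields the power sum to solve for, and degree `suc k` cancels.
    falling-pred : ∀ j k →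
      f j (suc k) ≈
      ∑[ r < k ] convolution-term (f (suc j)) g (suc k) (toℕ r) +
      (- 1# * (ι (suc k) * f (suc j) k) + f (suc j) (suc k))
    falling-pred j k = begin
      f j (suc k)
        ≈⟨ vandermonde (f-falling (suc j)) g-falling (pred-shift j) (f-falling j) (suc k) ⟩
      convolution (f (suc j)) g (suc k)
        ≈⟨ ∑-snoc₂ t k ⟩
      ∑[ r < k ] t (toℕ r) + (t k + t (suc k))
        ≈⟨ +-congˡ (+-cong t-k t-suc-k) ⟩
      ∑[ r < k ] t (toℕ r) + (- 1# * (ι (suc k) * f (suc j) k) + f (suc j) (suc k)) ∎
      where
      t = convolution-term (f (suc j)) g (suc k)
      t-k : t k ≈ - 1# * (ι (suc k) * f (suc j) k)
      t-k = begin
        ι (suc k C k) * (f (suc j) k * g (suc k ∸ k))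
          ≡⟨ cong₂ (λ p q → ι p * (f (suc j) k * g q)) ([1+n]Cn≡1+n k) (ℕ.m+n∸n≡m 1 k) ⟩
        ι (suc k) * (f (suc j) k * g 1)
          ≈⟨ *-congˡ (*-congˡ g-1) ⟩
        ι (suc k) * (f (suc j) k * - 1#)
          ≈⟨ solve 3 (λ p q e → p :* (q :* e) := e :* (p :* q)) refl (ι (suc k)) (f (suc j) k) (- 1#) ⟩
        - 1# * (ι (suc k) * f (suc j) k) ∎
      t-suc-k : t (suc k) ≈ f (suc j) (suc k)
      t-suc-k = begin
        ι (suc k C suc k) * (f (suc j) (suc k) * g (suc k ∸ suc k))
          ≡⟨ cong₂ (λ p q → ι p * (f (suc j) (suc k) * g q)) (nCn≡1 (suc k)) (ℕ.n∸n≡0 k) ⟩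
        ι 1 * (f (suc j) (suc k) * g 0)
          ≈⟨ *-cong ι-1 (*-congˡ (g-falling .base)) ⟩
        1# * (f (suc j) (suc k) * 1#)
          ≈⟨ solve 1 (λ p → con 1 :* (p :* con 1) := p) refl (f (suc j) (suc k)) ⟩
        f (suc j) (suc k) ∎

    -- After exchanging the sums, the coefficient is independent of `i` and can be pulled out.
    ∑-convolution-terms : ∀ n k →
      ∑[ i < n ] ∑[ r < k ] convolution-term (f (suc (toℕ i))) g (suc k) (toℕ r) ≈
      ∑[ r < k ] summand n k (toℕ r)
    ∑-convolution-terms n k = begin
      ∑[ i < n ] ∑[ r < k ] convolution-term (f (suc (toℕ i))) g (suc k) (toℕ r)
        ≈⟨ ∑-comm {n} {k} (λ i r → convolution-term (f (suc (toℕ i))) g (suc k) (toℕ r)) ⟩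
      ∑[ r < k ] ∑[ i < n ] convolution-term (f (suc (toℕ i))) g (suc k) (toℕ r)
        ≈⟨ sum-cong-≋ {k} (collect ∘ toℕ) ⟩
      ∑[ r < k ] summand n k (toℕ r) ∎
      where
      collect : ∀ r → ∑[ i < n ] convolution-term (f (suc (toℕ i))) g (suc k) r ≈ summand n k r
      collect r = begin
        ∑[ i < n ] convolution-term (f (suc (toℕ i))) g (suc k) r
          ≈⟨ sum-cong-≋ {n} (λ i → solve 4 (λ p a e q → p :* (a :* (e :* q)) := p :* e :* q :* a)
               refl (ι (suc k C r)) (f (suc (toℕ i)) r) ((- 1#) ^ (suc k ∸ r)) (h (suc k ∸ r))) ⟩
        ∑[ i < n ] (ι (suc k C r) * (- 1#) ^ (suc k ∸ r) * h (suc k ∸ r) * f (suc (toℕ i)) r)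
          ≈⟨ *-distribˡ-sum _ (λ i → f (suc (toℕ {n} i)) r) ⟨
        summand n k r ∎

    -- The power sum `A` of degree `suc k` occurs on both sides of `telescope` and cancels, which
    -- leaves an equation for `X`.
    power-sum-recurrence : ∀ n k →
      ι (suc k) * power-sum k n ≈ f n (suc k) + ∑[ r < k ] summand n k (toℕ r)
    power-sum-recurrence n k = +-cancelʳ A X (f n (suc k) + E) (begin
      X + A
        ≈⟨ +-congˡ telescope ⟩
      X + (E + (- 1# * X + A) + f n (suc k))
        ≈⟨ solve 5 (λ x e y a d → x :+ (e :+ (y :+ a) :+ d) := (x :+ y) :+ (d :+ e :+ a))
             refl X E (- 1# * X) A (f n (suc k)) ⟩
      (X + - 1# * X) + (f n (suc k) + E + A)
        ≈⟨ +-congʳ (trans (+-congˡ (-1*x≈-x X)) (-‿inverseʳ X)) ⟩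
      0# + (f n (suc k) + E + A)
        ≈⟨ +-identityˡ _ ⟩
      f n (suc k) + E + A ∎)
      where
      A = power-sum (suc k) n
      E = ∑[ r < k ] summand n k (toℕ r)
      X = ι (suc k) * power-sum k n
      ∑-pred : ∑[ i < n ] f (toℕ i) (suc k) ≈ E + (- 1# * X + A)
      ∑-pred = begin
        ∑[ i < n ] f (toℕ i) (suc k)
          ≈⟨ sum-cong-≋ {n} (λ i → falling-pred (toℕ i) k) ⟩
        ∑[ i < n ] (u i + (v i + w i))
          ≈⟨ ∑-distrib-+ {n} u (λ i → v i + w i) ⟩
        sum u + ∑[ i < n ] (v i + w i)
          ≈⟨ +-cong (∑-convolution-terms n k) (∑-distrib-+ {n} v w) ⟩
        E + (sum v + A)
          ≈⟨ +-congˡ (+-congʳ sum-v) ⟩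
        E + (- 1# * X + A) ∎
        where
        u v w : Fin n → Carrier
        u i = ∑[ r < k ] convolution-term (f (suc (toℕ i))) g (suc k) (toℕ r)
        v i = - 1# * (ι (suc k) * f (suc (toℕ i)) k)
        w i = f (suc (toℕ i)) (suc k)
        sum-v : sum v ≈ - 1# * X
        sum-v = begin
          sum v
            ≈⟨ *-distribˡ-sum (- 1#) (λ i → ι (suc k) * f (suc (toℕ {n} i)) k) ⟨
          - 1# * ∑[ i < n ] (ι (suc k) * f (suc (toℕ i)) k)
            ≈⟨ *-congˡ (*-distribˡ-sum (ι (suc k)) (λ i → f (suc (toℕ {n} i)) k)) ⟨
          - 1# * X ∎
      telescope : A ≈ E + (- 1# * X + A) + f n (suc k)
      telescope = begin
        A                                        ≈⟨ +-identityˡ A ⟨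
        0# + A                                   ≈⟨ +-congʳ (falling-0 (f-falling 0) k) ⟨
        -- By computation this is the sum of `f i (suc k)` for i from 0 to n; now its last summand
        -- is split off instead of its first.
        f 0 (suc k) + A                          ≈⟨ ∑-snoc (λ i → f i (suc k)) n ⟩
        ∑[ i < n ] f (toℕ i) (suc k) + f n (suc k) ≈⟨ +-congʳ ∑-pred ⟩
        E + (- 1# * X + A) + f n (suc k)         ∎

    -- The ring need not have division, so an inverse `d` of `ι (suc k)` is assumed; `1# * d` has
    -- the shape of `1ℝ ÷ suc k`.
    power-sum-formula : ∀ n k {d} → ι (suc k) * d ≈ 1# →
      power-sum k n ≈ f n (suc k) * d + (1# * d) * ∑[ r < k ] summand n k (toℕ r)
    power-sum-formula n k {d} inverse = begin
      P
        ≈⟨ *-identityˡ P ⟨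
      1# * P
        ≈⟨ *-congʳ inverse ⟨
      (ι (suc k) * d) * P
        ≈⟨ solve 3 (λ p d q → p :* d :* q := p :* q :* d) refl (ι (suc k)) d P ⟩
      (ι (suc k) * P) * d
        ≈⟨ *-congʳ (power-sum-recurrence n k) ⟩
      (f n (suc k) + E) * d
        ≈⟨ solve 3 (λ p q d → (p :+ q) :* d := p :* d :+ (con 1 :* d) :* q) refl (f n (suc k)) E d ⟩
      f n (suc k) * d + (1# * d) * E ∎
      where
      P = power-sum k n
      E = ∑[ r < k ] summand n k (toℕ r)

    -- Comparing the operations of ℝ with those of its ring bundle inside larger
    -- terms would unfold the Cauchy proofs, so that type checking does not end;
    -- hence they are exchanged as unapplied functions.
    power-sum-formula-with :
      ∀ {plus times : Carrier → Carrier → Carrier} {neg : Carrier → Carrier} {one : Carrier}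
        {power : Carrier → ℕ → Carrier} {divide : Carrier → Carrier}
        {∑′ : ∀ m → (Fin m → Carrier) → Carrier} {S : ℕ → ℕ → Carrier} n k {d} →
      _+_ ≡ plus → _*_ ≡ times → -_ ≡ neg → 1# ≡ one → _^_ ≡ power → (_* d) ≡ divide →
      sum-syntax ≡ ∑′ → power-sum ≡ S → ι (suc k) * d ≈ 1# →
      S k n ≈
        plus (divide (f n (suc k)))
          (times (divide one) (∑′ k λ r →
            times (times (times (ι (suc k C toℕ r)) (power (neg one) (suc k ∸ toℕ r)))
              (h (suc k ∸ toℕ r))) (S (toℕ r) n)))
    power-sum-formula-with n k ≡.refl ≡.refl ≡.refl ≡.refl ≡.refl ≡.refl ≡.refl ≡.refl =
      power-sum-formula n k

-- Natural numbers and their reciprocals in ℚ.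

-- `ℚ./` reduces to lowest terms and is stuck on variables; among unnormalised fractions the claim
-- is an integer identity.
/1-homo-+ : ∀ m n → + (m ℕ.+ n) ℚ./ 1 ≡ + m ℚ./ 1 ℚ.+ + n ℚ./ 1
/1-homo-+ m n = ℚ.toℚᵘ-injective (begin
  ℚ.toℚᵘ (fromℚᵘ (mkℚᵘ (+ (m ℕ.+ n)) 0))
    ≈⟨ ℚ.toℚᵘ-fromℚᵘ (mkℚᵘ (+ (m ℕ.+ n)) 0) ⟩
  mkℚᵘ (+ (m ℕ.+ n)) 0
    ≈⟨ *≡* (cong (ℤ._* (+ 1))
         (cong₂ ℤ._+_ (≡.sym (ℤ.*-identityʳ (+ m))) (≡.sym (ℤ.*-identityʳ (+ n))))) ⟩
  mkℚᵘ (+ m) 0 ℚᵘ.+ mkℚᵘ (+ n) 0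
    ≈⟨ ℚᵘ.+-cong (ℚ.toℚᵘ-fromℚᵘ (mkℚᵘ (+ m) 0)) (ℚ.toℚᵘ-fromℚᵘ (mkℚᵘ (+ n) 0)) ⟨
  ℚ.toℚᵘ (+ m ℚ./ 1) ℚᵘ.+ ℚ.toℚᵘ (+ n ℚ./ 1)
    ≈⟨ ℚ.toℚᵘ-homo-+ (+ m ℚ./ 1) (+ n ℚ./ 1) ⟨
  ℚ.toℚᵘ (+ m ℚ./ 1 ℚ.+ + n ℚ./ 1) ∎)
  where
  open ℚᵘ.≃-Reasoning

n/1*1/n≡1 : ∀ n → (+ suc n ℚ./ 1) ℚ.* (1ℤ ℚ./ suc n) ≡ 1ℚ
n/1*1/n≡1 n = ℚ.toℚᵘ-injective (begin
  ℚ.toℚᵘ ((+ suc n ℚ./ 1) ℚ.* (1ℤ ℚ./ suc n))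
    ≈⟨ ℚ.toℚᵘ-homo-* (+ suc n ℚ./ 1) (1ℤ ℚ./ suc n) ⟩
  ℚ.toℚᵘ (+ suc n ℚ./ 1) ℚᵘ.* ℚ.toℚᵘ (1ℤ ℚ./ suc n)
    ≈⟨ ℚᵘ.*-cong (ℚ.toℚᵘ-fromℚᵘ (mkℚᵘ (+ suc n) 0)) (ℚ.toℚᵘ-fromℚᵘ (mkℚᵘ 1ℤ n)) ⟩
  mkℚᵘ (+ suc n) 0 ℚᵘ.* mkℚᵘ 1ℤ n
    ≈⟨ ℚᵘ.*-inverseʳ (mkℚᵘ (+ suc n) 0) ⟩
  ℚᵘ.1ℚᵘ ∎)
  where
  open ℚᵘ.≃-Reasoning

-- The case of the real numbers.

open import Defs
open import Algebra.Properties.Semiring.Exp (CommutativeRing.semiring ℝ-commutativeRing)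
  using () renaming (_^_ to ring-^)

fromℕ-isNaturalEmbedding : IsNaturalEmbedding ℝ-commutativeRing fromℕ
fromℕ-isNaturalEmbedding = record
  { ι-0 = ≈-refl {0ℝ}
  ; ι-1 = ≈-refl {1ℝ}
  ; ι-+ = λ m n → pointwise {fromℕ (m ℕ.+ n)} {fromℕ m + fromℕ n} λ _ → /1-homo-+ m n
  }

-- Written in a type, _^_ is not inlined and hence stays syntactically the one of
-- the theorem; the term _^_ would be inlined.
^≡^ : ring-^ ≡ _^_
^≡^ = ≡.refl

theorem2p4 : (l : ℝ) (n k : ℕ) → .{{_ : NonZero n}} → .{{_ : NonZero k}} →
    S l k n ≈
    falling l (fromℕ n) (suc k) ÷ suc k
    + (1ℝ ÷ suc k) * (∑[ r < k ] (fromℕ (suc k C toℕ r) * (- 1ℝ) ^ (suc k ∸ toℕ r) * rising l 1ℝ (suc k ∸ toℕ r) * S l (toℕ r) n))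
theorem2p4 l n k =
  power-sum-formula-with {f = λ j → falling l (fromℕ j)} {h = rising l 1ℝ}
    (λ j → record
      { base = ≈-refl {1ℝ}
      ; step = λ m → ≈-refl {falling l (fromℕ j) (suc m)}
      })
    (record
      { base = ≈-refl {1ℝ}
      ; step = λ m → ≈-refl {rising l 1ℝ (suc m)}
      })
    {plus = _+_} {times = _*_} {neg = -_} {one = 1ℝ} {divide = _÷ suc k}
    {∑′ = sum-syntax} {S = S l} n k {fromℚ (1ℤ ℚ./ suc k)}
    ≡.refl ≡.refl ≡.refl ≡.refl ^≡^ ≡.refl ≡.refl ≡.refl
    -- `_÷ suc k` is multiplication by `fromℚ (1ℤ ℚ./ suc k)`, which therefore serves as `d`.
    (pointwise {fromℕ (suc k) * fromℚ (1ℤ ℚ./ suc k)} {1ℝ} λ _ → n/1*1/n≡1 k)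
  where open DegenerateFactorials ℝ-commutativeRing fromℕ-isNaturalEmbedding l
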